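{- Let $G=(V,E,\Sigma,\lambda)$ be a labeled directed graph with $n=|V|$ and $m=|E|$, and let $\mathcal{G}=(N,\Sigma,P,S)$ be a linear context-free grammar in terminal-anchored linear normal form (TALNF) over the same alphabet. The algorithm LinIndex-Build (defined in the context) runs on $(G,\mathcal{G})$ in time $O(|P|\cdot m\cdot n)$ and uses $O(|N|\cdot n^2)$ space. In particular, on sparse graphs with $m=O(n)$, the preprocessing time is $O(|P|\cdot n^2)$, which is subcubic in $n$.
   Context: A labeled directed graph is $G=(V,E,\Sigma,\lambda)$ with $V$ a finite set of vertices, $E\subseteq V\times V$ the directed edges, $\Sigma$ a finite alphabet, and $\lambda:E\to\Sigma$ a labeling of the edges. A context-free grammar is $\mathcal{G}=(N,\Sigma,P,S)$ with finite nonterminal set $N$, terminals $\Sigma$, productions $P$, start symbol $S\in N$; $|N|$ is the number of nonterminals and $|P|$ the number of productions. It is in TALNF if each production is one of $A\to a$, $A\to aB$, $A\to Ba$, or $S\to\varepsilon$, with $a\in\Sigma$ and $A,B\in N$. For $a\in\Sigma$ let $\mathrm{In}_a(v)=\{u\in V:(u,v)\in E,\ \lambda(u,v)=a\}$ and $\mathrm{Out}_a(u)=\{v\in V:(u,v)\in E,\ \lambda(u,v)=a\}$; these label-partitioned adjacency lists are precomputed. Algorithm LinIndex-Build$(G,\mathcal{G})$. Maintain matrices $M_A\in\{0,1\}^{V\times V}$ for $A\in N$ (initially all $0$), a witness table $W[A,u,v]$ (initially all undefined), and a queue $Q$ (initially empty). "Insert $(A,u,v)$ with record $w$" means: if $M_A[u,v]=0$,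 set $M_A[u,v]\gets 1$, $W[A,u,v]\gets w$, and enqueue $(A,u,v)$; otherwise do nothing. (1) For each production $A\to a$ in $P$ and each edge $(u,v)\in E$ with $\lambda(u,v)=a$, insert $(A,u,v)$ with record $\langle\mathsf{term},(u,v)\rangle$. (2) If $S\to\varepsilon\in P$, for each $u\in V$ insert $(S,u,u)$ with record $\langle\mathsf{eps}\rangle$. (3) While $Q$ is nonempty: dequeue some $(B,x,v)$. For each production of the form $A\to aB$ in $P$ and each $u\in\mathrm{In}_a(x)$, insert $(A,u,v)$ with record $\langle\mathsf{linL},a,(u,x),B\rangle$. For each production of the form $A\to Ba$ in $P$ and each $w\in\mathrm{Out}_a(v)$, insert $(A,x,w)$ with record $\langle\mathsf{linR},B,a,(v,w)\rangle$. Return $\{M_A\}$ and $W$. -}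

module Defs where

open import Data.Bool using (Bool; true; false; if_then_else_)
open import Data.Fin using (Fin; _≟_)
open import Data.List using (List; []; _∷_; length; map; mapMaybe; filter; allFin; lookup; removeAt; _∷ʳ_)
import Data.List.Properties as List
open import Data.List.Relation.Unary.All using (All)
open import Data.List.Relation.Unary.Unique.Propositional using (Unique)
import Data.List.Membership.DecPropositional as DecMembership
open import Data.Maybe using (Maybe; just; nothing)
open import Data.Nat using (ℕ; suc; _+_; _*_; _≤_; _⊔_)
open import Data.Product using (_×_; _,_; proj₁; proj₂)
import Data.Product.Properties as Product
open import Data.Sum using (_⊎_; inj₁; inj₂)
import Data.Sum.Properties as Sum
open import Data.Vec using (Vec; replicate; _[_]%=_; _[_]≔_)
import Data.Vec as Vec
open import Function using (id; _∘_; flip)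
open import Function.Definitions using (Injective)
open import Induction.WellFounded using (Acc)
open import Relation.Binary using (DecidableEquality)
open import Relation.Binary.Construct.Closure.ReflexiveTransitive using (Star)
open import Relation.Binary.PropositionalEquality using (_≡_)
open import Relation.Nullary using (does)
open import Relation.Nullary.Decidable using (_×-dec_)

-- V = Fin ∣V∣ and Σ = Fin σ.  The edge set E ⊆ V × V is the image of the
-- injection `endpoints`, so ∣E∣ is its cardinality and a labelling E → Σ is a
-- function on Fin ∣E∣.
record LabeledDigraph (σ : ℕ) : Set where
  field
    ∣V∣ ∣E∣             : ℕ
    endpoints           : Fin ∣E∣ → Fin ∣V∣ × Fin ∣V∣
    endpoints-injective : Injective _≡_ _≡_ endpoints
    label               : Fin ∣E∣ → Fin σ

  source target : Fin ∣E∣ → Fin ∣V∣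
  source = proj₁ ∘ endpoints
  target = proj₂ ∘ endpoints

  In Out : Fin σ → Fin ∣V∣ → List (Fin ∣V∣)
  In  a v = map source (filter (λ e → target e ≟ v ×-dec label e ≟ a) (allFin ∣E∣))
  Out a u = map target (filter (λ e → source e ≟ u ×-dec label e ≟ a) (allFin ∣E∣))

pattern nt A = inj₁ A
pattern tm a = inj₂ a

Production : ℕ → ℕ → Set
Production k σ = Fin k × List (Fin k ⊎ Fin σ)

_≟ₚ_ : ∀ {k σ} → DecidableEquality (Production k σ)
_≟ₚ_ = Product.≡-dec _≟_ (List.≡-dec (Sum.≡-dec _≟_ _≟_))

record CFG (σ : ℕ) : Set where
  field
    ∣N∣         : ℕ
    productions : List (Production ∣N∣ σ)
    distinct    : Unique productions
    start       : Fin ∣N∣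

  ∣P∣ : ℕ
  ∣P∣ = length productions

data TALNFProduction {k σ} (S : Fin k) : Production k σ → Set where
  A→a  : ∀ A a   → TALNFProduction S (A , tm a ∷ [])
  A→aB : ∀ A a B → TALNFProduction S (A , tm a ∷ nt B ∷ [])
  A→Ba : ∀ A B a → TALNFProduction S (A , nt B ∷ tm a ∷ [])
  S→ε  : TALNFProduction S (S , [])

TALNF : ∀ {σ} → CFG σ → Set
TALNF 𝒢 = All (TALNFProduction start) productions
  where open CFG 𝒢

-- LinIndex-Build as an instrumented program.  Cost model: a unit-cost RAM on
-- which every table access, queue operation, loop iteration and loop test is
-- one step.  As with In and Out, the productions having a given nonterminal on
-- the right-hand side can be enumerated directly, and the tables are available
-- in their initial state (all 0, all undefined) at no time cost.
module LinIndexBuild {σ : ℕ} (G : LabeledDigraph σ) (𝒢 : CFG σ) where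
  open LabeledDigraph G
  open CFG 𝒢

  V N T : Set
  V = Fin ∣V∣
  N = Fin ∣N∣
  T = Fin σ

  data Record : Set where
    term : V × V → Record
    eps  : Record
    linL : T → V × V → N → Record
    linR : N → T → V × V → Record

  Table : Set → Set
  Table X = Vec (Vec (Vec X ∣V∣) ∣V∣) ∣N∣

  constant : ∀ {X} → X → Table X
  constant x = replicate _ (replicate _ (replicate _ x))

  read : ∀ {X} → Table X → N × V × V → X
  read t (A , u , v) = Vec.lookup (Vec.lookup (Vec.lookup t A) u) v

  write : ∀ {X} → N × V × V → X → Table X → Table X
  write (A , u , v) x t = t [ A ]%= (_[ u ]%= (_[ v ]≔ x))

  record State : Set where
    field
      M     : Table Bool
      W     : Table (Maybe Record)
      Q     : List (N × V × V)
      clock : ℕ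
      peak  : ℕ
  open State public

  -- Space is measured in words, each holding a bit, a tag, a vertex, a
  -- nonterminal or a terminal.  It covers M, W and Q; the read-only input is
  -- not included.
  recordWords : Maybe Record → ℕ
  recordWords nothing             = 1
  recordWords (just (term _))     = 3
  recordWords (just eps)          = 1
  recordWords (just (linL _ _ _)) = 5
  recordWords (just (linR _ _ _)) = 5

  tableWords : ∀ {X} → (X → ℕ) → Table X → ℕ
  tableWords f = Vec.sum ∘ Vec.map (Vec.sum ∘ Vec.map (Vec.sum ∘ Vec.map f))

  space : Table Bool → Table (Maybe Record) → List (N × V × V) → ℕ
  space m w q = tableWords (λ _ → 1) m + tableWords recordWords w + 3 * length q

  -- Every modification of M, W or Q below is followed by a tick, so `peak` is
  -- the maximum of the space over all configurations passed through.
  tick : State → State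
  tick s = record s
    { clock = suc (clock s)
    ; peak  = peak s ⊔ space (M s) (W s) (Q s)
    }

  ticks : ℕ → State → State
  ticks 0       = id
  ticks (suc k) = ticks k ∘ tick

  forEach : ∀ {X : Set} → List X → (X → State → State) → State → State
  forEach []       body s = tick s
  forEach (x ∷ xs) body s = forEach xs body (body x (tick s))

  setM : N × V × V → State → State
  setM t s = tick (record s { M = write t true (M s) })

  setW : N × V × V → Record → State → State
  setW t w s = tick (record s { W = write t (just w) (W s) })

  enqueue : N × V × V → State → State
  enqueue t s = tick (record s { Q = Q s ∷ʳ t })

  dequeue : (s : State) → Fin (length (Q s)) → State
  dequeue s i = tick (record s { Q = removeAt (Q s) i })

  insert : N × V × V → Record → State → State
  insert t w s =
    if read (M s) t then tick s
    else enqueue t (setW t w (setM t (tick s)))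

  empty : State
  empty = record
    { M     = constant false
    ; W     = constant nothing
    ; Q     = []
    ; clock = 0
    ; peak  = space (constant false) (constant nothing) []
    }

  insertTerm : N → T → Fin ∣E∣ → State → State
  insertTerm A a e s =
    if does (label e ≟ a)
    then insert (A , source e , target e) (term (endpoints e)) (tick s)
    else tick s

  applyTerm : Production ∣N∣ σ → State → State
  applyTerm (A , tm a ∷ []) = forEach (allFin ∣E∣) (insertTerm A a)
  applyTerm _               = id

  step₁ : State → State
  step₁ = forEach productions applyTerm

  open DecMembership (_≟ₚ_ {∣N∣} {σ}) using (_∈?_)

  -- Testing S→ε ∈ P is charged as a scan of P.
  step₂ : State → State
  step₂ s =
    if does ((start , []) ∈? productions)
    then forEach (allFin ∣V∣) (λ u → insert (start , u , u) eps) (ticks ∣P∣ s)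
    else ticks ∣P∣ s

  matchL : N → Production ∣N∣ σ → Maybe (N × T)
  matchL B (A , tm a ∷ nt B′ ∷ []) = if does (B ≟ B′) then just (A , a) else nothing
  matchL B _                       = nothing

  matchR : N → Production ∣N∣ σ → Maybe (N × T)
  matchR B (A , nt B′ ∷ tm a ∷ []) = if does (B ≟ B′) then just (A , a) else nothing
  matchR B _                       = nothing

  -- (A , a) ∈ rulesL B iff A → aB is in P;  (A , a) ∈ rulesR B iff A → Ba is.
  rulesL rulesR : N → List (N × T)
  rulesL B = mapMaybe (matchL B) productions
  rulesR B = mapMaybe (matchR B) productions

  extendL extendR : N × V × V → N × T → State → State
  extendL (B , x , v) (A , a) =
    forEach (In a x) (λ u → insert (A , u , v) (linL a (u , x) B))
  extendR (B , x , v) (A , a) =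
    forEach (Out a v) (λ w → insert (A , x , w) (linR B a (v , w)))

  process : N × V × V → State → State
  process t@(B , _ , _) = forEach (rulesR B) (extendR t) ∘ forEach (rulesL B) (extendL t)

  -- The state on reaching the while loop.  The final tick here and in _⟶_ is
  -- the test whether Q is nonempty.
  initial : State
  initial = tick (step₂ (step₁ empty))

  -- One iteration of the while loop; the dequeued element is arbitrary.  The
  -- states with no successor are exactly those with empty Q.
  data _⟶_ (s : State) : State → Set where
    iterate : (i : Fin (length (Q s))) →
              s ⟶ tick (process (lookup (Q s) i) (dequeue s i))

  _⟶*_ : State → State → Set
  _⟶*_ = Star _⟶_

  Terminates : Set
  Terminates = Acc (flip _⟶_) initial

  RunsInTime : ℕ → Set
  RunsInTime b = Terminates × (∀ {s} → initial ⟶* s → clock s ≤ b)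

  UsesSpace : ℕ → Set
  UsesSpace b = ∀ {s} → initial ⟶* s → peak s ≤ b

open LabeledDigraph public using (∣V∣; ∣E∣)
open CFG public using (∣N∣; ∣P∣)
open LinIndexBuild public using (RunsInTime; UsesSpace)

{-# OPTIONS --safe #-}

-- Amortised analysis.  A triple t = (B , x , v) carries the charge
-- 18 · r(B) · d(x , v), where r(B) counts the occurrences of B in the
-- productions and d(x , v) = deg x + deg v + [v = x].  A triple is only ever
-- inserted if r(B) ≥ 1 and d(x , v) ≥ 1 (x is a source, v is a target, or
-- x = v), and then its charge covers the iteration that dequeues it.  Inserting t
-- moves its charge from the unset entries of M to the queue and dequeuing t
-- spends it, so the clock plus the remaining charge grows only in the
-- initialisation.  As Σ r(B) ≤ 2∣P∣ and Σ d(x , v) ≤ ∣V∣ (1 + 4∣E∣), the total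
-- charge is O(∣P∣ ∣E∣ ∣V∣).  With all charges equal to 1 the same accounting
-- bounds the queue by ∣N∣ ∣V∣² and shows termination.

module Submission where

import Algebra.Properties.Semiring.Sum
open import Data.Bool using (Bool; true; false; if_then_else_)
open import Data.Fin using (Fin; zero; suc; _≟_)
open import Data.List
  using (List; []; _∷_; _++_; length; map; mapMaybe; concatMap; filter; allFin; lookup; removeAt; _∷ʳ_)
open import Data.List.Membership.Propositional using (_∈_)
open import Data.List.Membership.Propositional.Properties
  using (∈-allFin; ∈-lookup; ∈-map⁻; ∈-concatMap⁺)
import Data.List.Membership.DecPropositional as DecMembership
open import Data.List.Properties using (length-++; length-map; length-tabulate; map-++)
open import Data.List.Relation.Unary.All as All using (All; []; _∷_)
import Data.List.Relation.Unary.All.Properties as All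
open import Data.List.Relation.Unary.Any using (here; there)
import Data.List.Relation.Unary.Any as Any
open import Data.Maybe using (Maybe; just; nothing)
open import Data.Nat using (ℕ; zero; suc; _+_; _*_; _^_; _/_; _≤_; z≤n; s≤s; NonZero)
open import Data.Nat.DivMod using (/-monoˡ-≤; m*n/n≡m)
open import Data.Nat.ListAction using (sum)
open import Data.Nat.ListAction.Properties using (sum-++)
open import Data.Nat.Properties hiding (_≟_)
open import Data.Nat.Tactic.RingSolver using (solve-∀)
open import Data.Product using (_×_; _,_; proj₂; ∃-syntax)
open import Data.Sum using (isInj₁)
open import Data.Vec using (Vec; []; _∷_)
import Data.Vec as Vec
open import Data.Vec.Properties using (lookup-replicate)
open import Function using (_∘_; flip)
open import Induction.WellFounded using (Acc; acc)
open import Relation.Binary.Construct.Closure.ReflexiveTransitive using (ε; _◅_)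
open import Relation.Binary.PropositionalEquality
  using (_≡_; refl; sym; trans; cong; cong₂; subst; module ≡-Reasoning)
open import Relation.Nullary using (yes; no; does)
open import Relation.Nullary.Decidable using (dec-true)
open import Relation.Unary using (Decidable)
open import Defs

open Algebra.Properties.Semiring.Sum +-*-semiring
  using (sum-cong-≗; sum-syntax; ∑-distrib-+; *-distribˡ-sum; *-distribʳ-sum)
  renaming (sum to ∑)

private variable
  X Y : Set
  n   : ℕ

-- Finite sums, occurrence counts and lists

∑-const : ∀ n c → ∑[ i < n ] c ≡ n * c
∑-const zero    c = refl
∑-const (suc n) c = cong (c +_) (∑-const n c)

-- A sum of indicators, so that summing over `i` exchanges with the recursion on the list.
occurrences : Fin n → List (Fin n) → ℕ
occurrences i []       = 0
occurrences i (j ∷ js) = (if does (i ≟ j) then 1 else 0) + occurrences i js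

∑-indicator : (j : Fin n) → ∑[ i < n ] (if does (i ≟ j) then 1 else 0) ≡ 1
∑-indicator {suc n} zero    = cong suc (trans (∑-const n 0) (*-zeroʳ n))
∑-indicator {suc n} (suc j) = ∑-indicator j

∑-occurrences : (js : List (Fin n)) → ∑[ i < n ] occurrences i js ≡ length js
∑-occurrences {n} []       = trans (∑-const n 0) (*-zeroʳ n)
∑-occurrences     (j ∷ js) = trans (∑-distrib-+ _ (λ i → occurrences i js))
  (cong₂ _+_ (∑-indicator j) (∑-occurrences js))

∈⇒1≤occurrences : {i : Fin n} {js : List (Fin n)} → i ∈ js → 1 ≤ occurrences i js
∈⇒1≤occurrences {i = i} (here {j} refl) rewrite dec-true (i ≟ i) refl = s≤s z≤n
∈⇒1≤occurrences         (there i∈js)    = m≤n⇒m≤o+n _ (∈⇒1≤occurrences i∈js)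

occurrences-++ : (i : Fin n) (js ks : List (Fin n)) →
                 occurrences i (js ++ ks) ≡ occurrences i js + occurrences i ks
occurrences-++ i []       ks = refl
occurrences-++ i (j ∷ js) ks = trans (cong (δ +_) (occurrences-++ i js ks)) (sym (+-assoc δ (occurrences i js) _))
  where δ = if does (i ≟ j) then 1 else 0

module _ (i : Fin n) (g : X → List (Fin n)) where

  occurrences-concatMap-∷ : ∀ x xs →
    occurrences i (concatMap g (x ∷ xs)) ≡ occurrences i (g x) + occurrences i (concatMap g xs)
  occurrences-concatMap-∷ x xs = occurrences-++ i (g x) (concatMap g xs)

  -- Every `x` that passes the filter contributes an occurrence of `i` through `g x`. With `g`
  -- listing the ends of an edge, this bounds `In` and `Out` by degrees.
  length-filter≤occurrences : {P : X → Set} (P? : Decidable P) → (∀ {x} → P x → i ∈ g x) →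
    ∀ xs → length (filter P? xs) ≤ occurrences i (concatMap g xs)
  length-filter≤occurrences P? P⇒∈ []       = z≤n
  length-filter≤occurrences P? P⇒∈ (x ∷ xs) rewrite occurrences-concatMap-∷ x xs with P? x
  ... | yes px = +-mono-≤ (∈⇒1≤occurrences (P⇒∈ px)) (length-filter≤occurrences P? P⇒∈ xs)
  ... | no _   = m≤n⇒m≤o+n _ (length-filter≤occurrences P? P⇒∈ xs)

  -- The same count for partial matches; with `g = nonterminals` it bounds the number of rules
  -- applicable to a nonterminal.
  length-mapMaybe≤occurrences : (f : X → Maybe Y) → (∀ {x y} → f x ≡ just y → i ∈ g x) →
    ∀ xs → length (mapMaybe f xs) ≤ occurrences i (concatMap g xs)
  length-mapMaybe≤occurrences f f⇒∈ []       = z≤n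
  length-mapMaybe≤occurrences f f⇒∈ (x ∷ xs) rewrite occurrences-concatMap-∷ x xs with f x in eq
  ... | just _  = +-mono-≤ (∈⇒1≤occurrences (f⇒∈ eq)) (length-mapMaybe≤occurrences f f⇒∈ xs)
  ... | nothing = m≤n⇒m≤o+n _ (length-mapMaybe≤occurrences f f⇒∈ xs)

∈-mapMaybe⁻ : (f : X → Maybe Y) {y : Y} (xs : List X) →
              y ∈ mapMaybe f xs → ∃[ x ] (x ∈ xs × f x ≡ just y)
∈-mapMaybe⁻ f (x ∷ xs) y∈ with f x in eq
... | nothing = let z , z∈ , fz = ∈-mapMaybe⁻ f xs y∈ in z , there z∈ , fz
∈-mapMaybe⁻ f (x ∷ xs) (here refl) | just _ = x , here refl , eq
∈-mapMaybe⁻ f (x ∷ xs) (there y∈)  | just _ = let z , z∈ , fz = ∈-mapMaybe⁻ f xs y∈ in z , there z∈ , fz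

length-concatMap≤ : (g : X → List Y) (k : ℕ) {xs : List X} →
                    All (λ x → length (g x) ≤ k) xs → length (concatMap g xs) ≤ length xs * k
length-concatMap≤ g k []                 = z≤n
length-concatMap≤ g k {x ∷ xs} (gx≤ ∷ gxs≤) =
  ≤-trans (≤-reflexive (length-++ (g x))) (+-mono-≤ gx≤ (length-concatMap≤ g k gxs≤))

sum-map-∷ʳ : (f : X → ℕ) (xs : List X) (x : X) → sum (map f (xs ∷ʳ x)) ≡ sum (map f xs) + f x
sum-map-∷ʳ f xs x = begin
  sum (map f (xs ∷ʳ x))         ≡⟨ cong sum (map-++ f xs (x ∷ [])) ⟩
  sum (map f xs ∷ʳ f x)         ≡⟨ sum-++ (map f xs) (f x ∷ []) ⟩
  sum (map f xs) + (f x + 0)    ≡⟨ cong (sum (map f xs) +_) (+-identityʳ (f x)) ⟩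
  sum (map f xs) + f x          ∎
  where open ≡-Reasoning

sum-map-removeAt : (f : X → ℕ) (xs : List X) (i : Fin (length xs)) →
                   sum (map f xs) ≡ f (lookup xs i) + sum (map f (removeAt xs i))
sum-map-removeAt f (x ∷ xs) zero    = refl
sum-map-removeAt f (x ∷ xs) (suc i) =
  trans (cong (f x +_) (sum-map-removeAt f xs i)) (swap (f x) (f (lookup xs i)) _)
  where
  swap : ∀ a b c → a + (b + c) ≡ b + (a + c)
  swap = solve-∀

sum-map-1 : (xs : List X) → sum (map (λ _ → 1) xs) ≡ length xs
sum-map-1 []       = refl
sum-map-1 (x ∷ xs) = cong suc (sum-map-1 xs)

All-removeAt : {P : X → Set} {xs : List X} (i : Fin (length xs)) → All P xs → All P (removeAt xs i)
All-removeAt zero    (_  ∷ pxs) = pxs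
All-removeAt (suc i) (px ∷ pxs) = px ∷ All-removeAt i pxs

vecSum≤ : (f : X → ℕ) (c : ℕ) → (∀ x → f x ≤ c) → (xs : Vec X n) → Vec.sum (Vec.map f xs) ≤ n * c
vecSum≤ f c f≤c []       = z≤n
vecSum≤ f c f≤c (x ∷ xs) = +-mono-≤ (f≤c x) (vecSum≤ f c f≤c xs)

-- Weights of vectors under point updates

total : (Fin n → X → ℕ) → Vec X n → ℕ
total {n} h xs = ∑[ i < n ] h i (Vec.lookup xs i)

-- Only the summand at `i` changes. The decrease appears as an added `d`, so hypothesis and
-- conclusion have the same shape and the lemma iterates through nested vectors.
total-updateAt : (h : Fin n → X → ℕ) (i : Fin n) (xs : Vec X n) {f : X → X} {d : ℕ} →
                 h i (f (Vec.lookup xs i)) + d ≡ h i (Vec.lookup xs i) →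
                 total h (Vec.updateAt xs i f) + d ≡ total h xs
total-updateAt h zero    (x ∷ xs) {f} {d} eq =
  trans (swap (h zero (f x)) _ d) (cong (_+ total (h ∘ suc) xs) eq)
  where
  swap : ∀ a b c → a + b + c ≡ a + c + b
  swap = solve-∀
total-updateAt h (suc i) (x ∷ xs) {f} {d} eq =
  trans (+-assoc (h zero x) _ d) (cong (h zero x +_) (total-updateAt (h ∘ suc) i xs eq))

total-replicate : (h : Fin n → X → ℕ) (x : X) → total h (Vec.replicate n x) ≡ ∑[ i < n ] h i x
total-replicate h x = sum-cong-≗ (λ i → cong (h i) (lookup-replicate i x))

-- The left-hand side is listed too: an inserted triple is headed by the left-hand side of some
-- production, and this alone must make `r` positive.
nonterminals : ∀ {k σ} → Production k σ → List (Fin k)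
nonterminals (A , rhs) = A ∷ mapMaybe isInj₁ rhs

length-nonterminals≤2 : ∀ {k σ} {S : Fin k} {π : Production k σ} →
                        TALNFProduction S π → length (nonterminals π) ≤ 2
length-nonterminals≤2 (A→a _ _)    = s≤s z≤n
length-nonterminals≤2 (A→aB _ _ _) = s≤s (s≤s z≤n)
length-nonterminals≤2 (A→Ba _ _ _) = s≤s (s≤s z≤n)
length-nonterminals≤2 S→ε          = s≤s z≤n

module _ {σ : ℕ} (G : LabeledDigraph σ) (𝒢 : CFG σ) where
  open LabeledDigraph G using (source; target; label; endpoints; In; Out)
  open CFG 𝒢 using (productions; start)
  open LinIndexBuild G 𝒢 hiding (RunsInTime; UsesSpace)

  -- Degrees, charges and applicable rules

  nonterminalOccurrences : List N
  nonterminalOccurrences = concatMap nonterminals productions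

  edgeEnds : List V
  edgeEnds = concatMap (λ e → source e ∷ target e ∷ []) (allFin (∣E∣ G))

  r : N → ℕ
  r B = occurrences B nonterminalOccurrences

  -- Prepending `x` encodes the indicator [v = x]. It keeps `d` positive on the diagonal even at
  -- isolated vertices, where `S → ε` still inserts triples.
  d : V → V → ℕ
  d x v = occurrences x edgeEnds + occurrences v (x ∷ edgeEnds)

  charge : N × V × V → ℕ
  charge (B , x , v) = 18 * r B * d x v

  -- If either factor vanished, the charge would be 0 and could not pay the fixed cost of an
  -- iteration.
  Allowed : N × V × V → Set
  Allowed (B , x , v) = 1 ≤ r B × 1 ≤ d x v

  volume : ℕ
  volume = ∣N∣ 𝒢 * (∣V∣ G * ∣V∣ G)

  source∈edgeEnds : ∀ e → source e ∈ edgeEnds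
  source∈edgeEnds e = ∈-concatMap⁺ _ (Any.map (λ { refl → here refl }) (∈-allFin e))

  target∈edgeEnds : ∀ e → target e ∈ edgeEnds
  target∈edgeEnds e = ∈-concatMap⁺ _ (Any.map (λ { refl → there (here refl) }) (∈-allFin e))

  In⊆edgeEnds : ∀ {a x u} → u ∈ In a x → u ∈ edgeEnds
  In⊆edgeEnds u∈ with ∈-map⁻ source u∈
  ... | e , _ , refl = source∈edgeEnds e

  Out⊆edgeEnds : ∀ {a x w} → w ∈ Out a x → w ∈ edgeEnds
  Out⊆edgeEnds w∈ with ∈-map⁻ target w∈
  ... | e , _ , refl = target∈edgeEnds e

  1≤d-source : ∀ {x} v → x ∈ edgeEnds → 1 ≤ d x v
  1≤d-source v x∈ = ≤-trans (∈⇒1≤occurrences x∈) (m≤m+n _ _)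

  1≤d-target : ∀ x {v} → v ∈ edgeEnds → 1 ≤ d x v
  1≤d-target x v∈ = m≤n⇒m≤o+n (occurrences x edgeEnds) (∈⇒1≤occurrences (there v∈))

  1≤d-diagonal : ∀ x → 1 ≤ d x x
  1≤d-diagonal x = m≤n⇒m≤o+n (occurrences x edgeEnds) (∈⇒1≤occurrences {js = x ∷ edgeEnds} (here refl))

  1≤r : ∀ {π A} → π ∈ productions → A ∈ nonterminals π → 1 ≤ r A
  1≤r π∈ A∈ = ∈⇒1≤occurrences (∈-concatMap⁺ _ (Any.map (λ { refl → A∈ }) π∈))

  -- An edge selected for `In a x` has `x` as its target, hence among its listed ends.
  length-In≤d : ∀ a x v → length (In a x) ≤ d x v
  length-In≤d a x v = begin
    length (In a x)         ≡⟨ length-map source (filter _ (allFin (∣E∣ G))) ⟩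
    length (filter _ (allFin (∣E∣ G)))
      ≤⟨ length-filter≤occurrences x _ _ (λ { (refl , _) → there (here refl) }) (allFin (∣E∣ G)) ⟩
    occurrences x edgeEnds  ≤⟨ m≤m+n _ _ ⟩
    d x v                   ∎
    where open ≤-Reasoning

  length-Out≤d : ∀ a x v → length (Out a v) ≤ d x v
  length-Out≤d a x v = begin
    length (Out a v)        ≡⟨ length-map target (filter _ (allFin (∣E∣ G))) ⟩
    length (filter _ (allFin (∣E∣ G)))
      ≤⟨ length-filter≤occurrences v _ _ (λ { (refl , _) → here refl }) (allFin (∣E∣ G)) ⟩
    occurrences v edgeEnds  ≤⟨ m≤n+m _ _ ⟩
    occurrences v (x ∷ edgeEnds)  ≤⟨ m≤n+m _ (occurrences x edgeEnds) ⟩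
    d x v                   ∎
    where open ≤-Reasoning

  matchL-just : ∀ {B π A a} → matchL B π ≡ just (A , a) → π ≡ (A , tm a ∷ nt B ∷ [])
  matchL-just {B} {A , tm a ∷ nt B′ ∷ []} eq with B ≟ B′
  matchL-just {B} {A , tm a ∷ nt B ∷ []} refl | yes refl = refl
  -- The catch-all clause of `matchL` reduces only once the right-hand side is split far enough to
  -- exclude the first clause.
  matchL-just {π = A , []} ()
  matchL-just {π = A , nt _ ∷ _} ()
  matchL-just {π = A , tm _ ∷ []} ()
  matchL-just {π = A , tm _ ∷ tm _ ∷ _} ()
  matchL-just {π = A , tm _ ∷ nt _ ∷ _ ∷ _} ()

  matchR-just : ∀ {B π A a} → matchR B π ≡ just (A , a) → π ≡ (A , nt B ∷ tm a ∷ [])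
  matchR-just {B} {A , nt B′ ∷ tm a ∷ []} eq with B ≟ B′
  matchR-just {B} {A , nt B ∷ tm a ∷ []} refl | yes refl = refl
  matchR-just {π = A , []} ()
  matchR-just {π = A , tm _ ∷ _} ()
  matchR-just {π = A , nt _ ∷ []} ()
  matchR-just {π = A , nt _ ∷ nt _ ∷ _} ()
  matchR-just {π = A , nt _ ∷ tm _ ∷ _ ∷ _} ()

  rulesL⇒1≤r : ∀ {B A a} → (A , a) ∈ rulesL B → 1 ≤ r A
  rulesL⇒1≤r {B} A∈ with ∈-mapMaybe⁻ (matchL B) productions A∈
  ... | π , π∈ , eq with matchL-just {B} {π} eq
  ... | refl = 1≤r π∈ (here refl)

  rulesR⇒1≤r : ∀ {B A a} → (A , a) ∈ rulesR B → 1 ≤ r A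
  rulesR⇒1≤r {B} A∈ with ∈-mapMaybe⁻ (matchR B) productions A∈
  ... | π , π∈ , eq with matchR-just {B} {π} eq
  ... | refl = 1≤r π∈ (here refl)

  -- A production matched by `matchL B` has `B` on its right-hand side, so it is counted in `r B`.
  length-rulesL≤r : ∀ B → length (rulesL B) ≤ r B
  length-rulesL≤r B = length-mapMaybe≤occurrences B nonterminals (matchL B) (λ {π} → B∈ {π}) productions
    where
    B∈ : ∀ {π y} → matchL B π ≡ just y → B ∈ nonterminals π
    B∈ {π} eq with matchL-just {B} {π} eq
    ... | refl = there (here refl)

  length-rulesR≤r : ∀ B → length (rulesR B) ≤ r B
  length-rulesR≤r B = length-mapMaybe≤occurrences B nonterminals (matchR B) (λ {π} → B∈ {π}) productions
    where
    B∈ : ∀ {π y} → matchR B π ≡ just y → B ∈ nonterminals π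
    B∈ {π} eq with matchR-just {B} {π} eq
    ... | refl = there (here refl)

  -- Space of the tables and the queue

  tableWords≤ : (f : X → ℕ) (c : ℕ) → (∀ x → f x ≤ c) → (t : Table X) →
                tableWords f t ≤ ∣N∣ 𝒢 * (∣V∣ G * (∣V∣ G * c))
  tableWords≤ f c f≤c = vecSum≤ _ _ (vecSum≤ _ _ (vecSum≤ f c f≤c))

  recordWords≤5 : ∀ w → recordWords w ≤ 5
  recordWords≤5 nothing             = s≤s z≤n
  recordWords≤5 (just (term _))     = s≤s (s≤s (s≤s z≤n))
  recordWords≤5 (just eps)          = s≤s z≤n
  recordWords≤5 (just (linL _ _ _)) = ≤-refl
  recordWords≤5 (just (linR _ _ _)) = ≤-refl

  -- Per triple: one word in `M`, at most five in `W` and three for a queue entry, hence 9 = 1 + 5 +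
  -- 3.
  space≤ : ∀ m w q → length q ≤ volume → space m w q ≤ 9 * volume
  space≤ m w q q≤ = begin
    space m w q
      ≤⟨ +-mono-≤ (+-mono-≤ (tableWords≤ _ 1 (λ _ → ≤-refl) m) (tableWords≤ _ 5 recordWords≤5 w))
                  (*-monoʳ-≤ 3 q≤) ⟩
    k * (v * (v * 1)) + k * (v * (v * 5)) + 3 * volume
      ≡⟨ collect k v ⟩
    9 * volume  ∎
    where
    open ≤-Reasoning
    k = ∣N∣ 𝒢
    v = ∣V∣ G
    collect : ∀ k v → k * (v * (v * 1)) + k * (v * (v * 5)) + 3 * (k * (v * v)) ≡ 9 * (k * (v * v))
    collect = solve-∀

  -- The potential

  cellWeight : (N × V × V → ℕ) → N → V → V → Bool → ℕ
  cellWeight f A u v b = if b then 0 else f (A , u , v)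

  rowWeight : (N × V × V → ℕ) → N → V → Vec Bool (∣V∣ G) → ℕ
  rowWeight f A u = total (cellWeight f A u)

  matrixWeight : (N × V × V → ℕ) → N → Vec (Vec Bool (∣V∣ G)) (∣V∣ G) → ℕ
  matrixWeight f A = total (rowWeight f A)

  unset : (N × V × V → ℕ) → Table Bool → ℕ
  unset f = total (matrixWeight f)

  -- The changed cell loses the weight `f t`, and this loss is passed up through the three levels of
  -- the table.
  unset-write : ∀ f t m → read m t ≡ false → unset f (write t true m) + f t ≡ unset f m
  unset-write f (A , u , v) m eq =
    total-updateAt (matrixWeight f) A m {f = Vec._[ u ]%= (Vec._[ v ]≔ true)}
      (total-updateAt (rowWeight f A) u (Vec.lookup m A) {f = Vec._[ v ]≔ true}
        (total-updateAt (cellWeight f A u) v (Vec.lookup (Vec.lookup m A) u) {f = λ _ → true}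
          (sym (cong (cellWeight f A u v) eq))))

  unset-constant : ∀ f → unset f (constant false) ≡ ∑[ A < ∣N∣ 𝒢 ] ∑[ u < ∣V∣ G ] ∑[ v < ∣V∣ G ] f (A , u , v)
  unset-constant f =
    trans (total-replicate (matrixWeight f) _) (sum-cong-≗ λ A →
      trans (total-replicate (rowWeight f A) _) (sum-cong-≗ λ u →
        total-replicate (cellWeight f A u) false))

  -- A triple keeps its weight until it is dequeued: first as an unset bit, then as a queue entry.
  potential : (N × V × V → ℕ) → Table Bool → List (N × V × V) → ℕ
  potential f m q = unset f m + sum (map f q)

  -- The weight `f t` moves from the cell to the new queue entry.
  potential-insert : ∀ f t m q → read m t ≡ false → potential f (write t true m) (q ∷ʳ t) ≡ potential f m q
  potential-insert f t m q eq = begin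
    unset f m′ + sum (map f (q ∷ʳ t))     ≡⟨ cong (unset f m′ +_) (sum-map-∷ʳ f q t) ⟩
    unset f m′ + (sum (map f q) + f t)    ≡⟨ swap (unset f m′) _ (f t) ⟩
    unset f m′ + f t + sum (map f q)      ≡⟨ cong (_+ sum (map f q)) (unset-write f t m eq) ⟩
    unset f m + sum (map f q)             ∎
    where
    open ≡-Reasoning
    m′ = write t true m
    swap : ∀ a b c → a + (b + c) ≡ a + c + b
    swap = solve-∀

  potential-dequeue : ∀ f m q i → potential f m q ≡ f (lookup q i) + potential f m (removeAt q i)
  potential-dequeue f m q i =
    trans (cong (unset f m +_) (sum-map-removeAt f q i)) (swap (unset f m) (f (lookup q i)) _)
    where
    swap : ∀ a b c → a + (b + c) ≡ b + (a + c)
    swap = solve-∀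

  length≤potential : ∀ m q → length q ≤ potential (λ _ → 1) m q
  length≤potential m q = ≤-trans (≤-reflexive (sym (sum-map-1 q))) (m≤n+m _ _)

  -- The invariant and the primitive operations

  -- slots bounds the number of iterations still to come, budget the final clock.
  record Within (slots budget : ℕ) (s : State) : Set where
    field
      allowed    : All Allowed (Q s)
      slots≤     : slots ≤ volume
      potential≤ : potential (λ _ → 1) (M s) (Q s) ≤ slots
      clock≤     : clock s + potential charge (M s) (Q s) ≤ budget
      peak≤      : peak s ≤ 9 * volume

    length≤volume : length (Q s) ≤ volume
    length≤volume = ≤-trans (length≤potential (M s) (Q s)) (≤-trans potential≤ slots≤)
  open Within

  private variable
    slots b b′ : ℕ
    s          : State

  weaken : b ≤ b′ → Within slots b s → Within slots b′ s
  weaken b≤b′ w = record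
    { allowed = w .allowed ; slots≤ = w .slots≤ ; potential≤ = w .potential≤
    ; clock≤ = ≤-trans (w .clock≤) b≤b′ ; peak≤ = w .peak≤ }

  tick-peak≤ : ∀ s → length (Q s) ≤ volume → peak s ≤ 9 * volume → peak (tick s) ≤ 9 * volume
  tick-peak≤ s q≤ p≤ = ⊔-lub p≤ (space≤ (M s) (W s) (Q s) q≤)

  tick-within : Within slots b s → Within slots (suc b) (tick s)
  tick-within {s = s} w = record
    { allowed = w .allowed ; slots≤ = w .slots≤ ; potential≤ = w .potential≤
    ; clock≤ = s≤s (w .clock≤) ; peak≤ = tick-peak≤ s (length≤volume w) (w .peak≤) }

  ticks-within : ∀ k → Within slots b s → Within slots (k + b) (ticks k s)
  ticks-within         zero    w = w
  ticks-within {b = b} (suc k) w = weaken (≤-reflexive (+-suc k b)) (ticks-within k (tick-within w))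

  -- The 4 pays for the test of the bit, the two writes and the enqueueing; both potentials are
  -- unchanged.
  insert-within : ∀ {t} rec → Allowed t → Within slots b s → Within slots (4 + b) (insert t rec s)
  insert-within {slots} {b} {s} {t} rec t-allowed w with read (M s) t in eq
  ... | true  = weaken (+-monoˡ-≤ b (s≤s z≤n)) (tick-within w)
  ... | false = record
    { allowed    = All.∷ʳ⁺ (w .allowed) t-allowed
    ; slots≤     = w .slots≤
    ; potential≤ = new-potential≤
    ; clock≤     = s≤s (s≤s (s≤s (s≤s (subst (λ p → clock s + p ≤ b)
                     (sym (potential-insert charge t (M s) (Q s) eq)) (w .clock≤)))))
    -- All four ticks are checked. The queue is longer only at the last one, where the unit
    -- potential again bounds its length.
    ; peak≤      = tick-peak≤ (record s₂ { Q = Q s ∷ʳ t })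
                     (≤-trans (length≤potential (write t true (M s)) (Q s ∷ʳ t)) (≤-trans new-potential≤ (w .slots≤)))
                     (tick-peak≤ (record s₁ { W = write t (just rec) (W s) }) q≤
                       (tick-peak≤ (record s₀ { M = write t true (M s) }) q≤ (tick-peak≤ s q≤ (w .peak≤))))
    }
    where
    s₀ = tick s
    s₁ = setM t s₀
    s₂ = setW t rec s₁
    q≤ = length≤volume w
    new-potential≤ : potential (λ _ → 1) (write t true (M s)) (Q s ∷ʳ t) ≤ slots
    new-potential≤ = subst (_≤ slots) (sym (potential-insert (λ _ → 1) t (M s) (Q s) eq)) (w .potential≤)

  -- Each element costs one loop test and the body; the leading 1 is the test that ends the loop.
  -- The membership `x ∈ xs` is what lets a body show that its triples are `Allowed`.
  forEach-within : ∀ c (xs : List X) {body} →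
    (∀ {x b s} → x ∈ xs → Within slots b s → Within slots (c + b) (body x s)) →
    Within slots b s → Within slots (1 + length xs * (1 + c) + b) (forEach xs body s)
  forEach-within         c []       body-within w = tick-within w
  forEach-within {b = b} c (x ∷ xs) body-within w =
    weaken (≤-reflexive (rearrange c (length xs) b))
      (forEach-within c xs (λ x∈ → body-within (there x∈)) (body-within (here refl) (tick-within w)))
    where
    rearrange : ∀ c l b → 1 + l * (1 + c) + (c + (1 + b)) ≡ 1 + (1 + l) * (1 + c) + b
    rearrange = solve-∀

  -- Initialisation

  insertTerm-within : ∀ {A a e} → 1 ≤ r A → Within slots b s → Within slots (5 + b) (insertTerm A a e s)
  insertTerm-within {b = b} {A = A} {a} {e} 1≤rA w with does (label e ≟ a)
  ... | true  = weaken (≤-reflexive (+-suc 4 b))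
                  (insert-within _ (1≤rA , 1≤d-source (target e) (source∈edgeEnds e)) (tick-within w))
  ... | false = weaken (+-monoˡ-≤ b (s≤s z≤n)) (tick-within w)

  applyTerm-within : ∀ {π} → π ∈ productions → Within slots b s →
                     Within slots (1 + ∣E∣ G * 6 + b) (applyTerm π s)
  -- For these shapes `applyTerm` is `id` and spends nothing.
  applyTerm-within {b = b} {π = A , []}           _  w = weaken (m≤n+m b _) w
  applyTerm-within {b = b} {π = A , nt _ ∷ _}     _  w = weaken (m≤n+m b _) w
  applyTerm-within {b = b} {π = A , tm _ ∷ _ ∷ _} _  w = weaken (m≤n+m b _) w
  applyTerm-within {slots} {b} {s} {π = A , tm a ∷ []}      π∈ w =
    subst (λ l → Within slots (1 + l * 6 + b) (applyTerm (A , tm a ∷ []) s)) (length-tabulate {n = ∣E∣ G} _)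
      (forEach-within 5 (allFin (∣E∣ G)) (λ _ → insertTerm-within (1≤r π∈ (here refl))) w)

  step₁-within : Within slots b s →
                 Within slots (1 + ∣P∣ 𝒢 * (1 + (1 + ∣E∣ G * 6)) + b) (step₁ s)
  step₁-within = forEach-within _ productions applyTerm-within

  open DecMembership (_≟ₚ_ {∣N∣ 𝒢} {σ}) using (_∈?_)

  -- The scan is paid in both branches. The inserted triples are allowed because `start` heads the
  -- production `S → ε` and they lie on the diagonal.
  step₂-within : Within slots b s → Within slots (1 + ∣V∣ G * 5 + (∣P∣ 𝒢 + b)) (step₂ s)
  step₂-within {slots} {b} {s} w with (start , []) ∈? productions
  ... | yes ε∈ = subst (λ l → Within slots (1 + l * 5 + (∣P∣ 𝒢 + b)) (forEach (allFin (∣V∣ G)) body (ticks (∣P∣ 𝒢) s)))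
    (length-tabulate {n = ∣V∣ G} _)
    (forEach-within 4 (allFin (∣V∣ G)) {body}
      (λ {u} _ → insert-within eps (1≤r ε∈ (here refl) , 1≤d-diagonal u)) (ticks-within (∣P∣ 𝒢) w))
    where
    body : V → State → State
    body u = insert (start , u , u) eps
  ... | no _   = weaken (m≤n+m (∣P∣ 𝒢 + b) (1 + ∣V∣ G * 5)) (ticks-within (∣P∣ 𝒢) w)

  totalCharge : ℕ
  totalCharge = unset charge (constant false)

  -- From the inside out: the charge of all triples, `step₁`, the scan and the loop of `step₂`, and
  -- the first test of the queue.
  initialBudget : ℕ
  initialBudget =
    1 + (1 + ∣V∣ G * 5 + (∣P∣ 𝒢 + (1 + ∣P∣ 𝒢 * (1 + (1 + ∣E∣ G * 6)) + totalCharge)))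

  empty-within : Within volume totalCharge empty
  empty-within = record
    { allowed    = []
    ; slots≤     = ≤-refl
    -- Every bit is unset and the queue is empty, so the unit potential is the number of triples.
    ; potential≤ = ≤-reflexive (trans (+-identityʳ _) (trans (unset-constant _) ∑∑∑1≡volume))
    ; clock≤     = ≤-reflexive (+-identityʳ _)
    ; peak≤      = space≤ (constant false) (constant nothing) [] z≤n
    }
    where
    open ≡-Reasoning
    ∑∑∑1≡volume : ∑[ A < ∣N∣ 𝒢 ] ∑[ u < ∣V∣ G ] ∑[ v < ∣V∣ G ] 1 ≡ volume
    ∑∑∑1≡volume = begin
      ∑[ A < ∣N∣ 𝒢 ] ∑[ u < ∣V∣ G ] ∑[ v < ∣V∣ G ] 1
        ≡⟨ ∑-const (∣N∣ 𝒢) _ ⟩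
      ∣N∣ 𝒢 * ∑[ u < ∣V∣ G ] ∑[ v < ∣V∣ G ] 1
        ≡⟨ cong (∣N∣ 𝒢 *_) (∑-const (∣V∣ G) _) ⟩
      ∣N∣ 𝒢 * (∣V∣ G * ∑[ v < ∣V∣ G ] 1)
        ≡⟨ cong (λ k → ∣N∣ 𝒢 * (∣V∣ G * k)) (trans (∑-const (∣V∣ G) 1) (*-identityʳ _)) ⟩
      volume  ∎

  initial-within : Within volume initialBudget initial
  initial-within = tick-within (step₂-within (step₁-within empty-within))

  -- The while loop

  extendL-within : ∀ B x v {A a} → 1 ≤ r A → Within slots b s →
                   Within slots (1 + d x v * 5 + b) (extendL (B , x , v) (A , a) s)
  extendL-within {b = b} B x v {A} {a} 1≤rA w =
    weaken (+-monoˡ-≤ b (s≤s (*-monoˡ-≤ 5 (length-In≤d a x v))))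
      (forEach-within 4 (In a x) (λ u∈ → insert-within _ (1≤rA , 1≤d-source v (In⊆edgeEnds {a} {x} u∈))) w)

  extendR-within : ∀ B x v {A a} → 1 ≤ r A → Within slots b s →
                   Within slots (1 + d x v * 5 + b) (extendR (B , x , v) (A , a) s)
  extendR-within {b = b} B x v {A} {a} 1≤rA w =
    weaken (+-monoˡ-≤ b (s≤s (*-monoˡ-≤ 5 (length-Out≤d a x v))))
      (forEach-within 4 (Out a v) (λ w∈ → insert-within _ (1≤rA , 1≤d-target x (Out⊆edgeEnds {a} {v} w∈))) w)

  -- The charge of `t` pays for both rule loops, the next test of the queue, and the 1 in the
  -- incoming budget, which stands for the tick of `dequeue`.
  process-within : ∀ t → Allowed t → Within slots (1 + b) s → Within slots (charge t + b) (tick (process t s))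
  process-within {slots} {b} t@(B , x , v) (1≤rB , 1≤dxv) w = weaken cost≤charge (tick-within
    (forEach-within _ (rulesR B) (λ A∈ → extendR-within B x v (rulesR⇒1≤r {B} A∈))
      (forEach-within _ (rulesL B) (λ A∈ → extendL-within B x v (rulesL⇒1≤r {B} A∈)) w)))
    where
    open ≤-Reasoning
    loop : ℕ → ℕ
    loop l = 1 + l * (1 + (1 + d x v * 5))
    loop≤ : ∀ {l} → l ≤ r B → loop l ≤ loop (r B)
    loop≤ l≤ = s≤s (*-monoˡ-≤ (1 + (1 + d x v * 5)) l≤)
    -- Apart from `b` the left side is 4 + 4p + 10pq, which is at most 18pq for p, q ≥ 1. Equality
    -- at p = q = 1 fixes the factor 18 in `charge`.
    arithmetic : ∀ {p q} → 1 ≤ p → 1 ≤ q →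
      1 + (1 + p * (1 + (1 + q * 5)) + (1 + p * (1 + (1 + q * 5)) + (1 + b))) ≤ 18 * p * q + b
    arithmetic {suc p} {suc q} _ _ = m+n≤o⇒m≤o _ (≤-reflexive (sym (difference p q b)))
      where
      difference : ∀ p q b → 18 * (1 + p) * (1 + q) + b ≡
        1 + (1 + (1 + p) * (1 + (1 + (1 + q) * 5)) + (1 + (1 + p) * (1 + (1 + (1 + q) * 5)) + (1 + b)))
          + (4 * p + 8 * q + 8 * (p * q))
      difference = solve-∀
    cost≤charge : 1 + (loop (length (rulesR B)) + (loop (length (rulesL B)) + (1 + b))) ≤ charge t + b
    cost≤charge = begin
      1 + (loop (length (rulesR B)) + (loop (length (rulesL B)) + (1 + b)))
        ≤⟨ s≤s (+-mono-≤ (loop≤ (length-rulesR≤r B)) (+-monoˡ-≤ (1 + b) (loop≤ (length-rulesL≤r B)))) ⟩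
      1 + (loop (r B) + (loop (r B) + (1 + b)))
        ≤⟨ arithmetic 1≤rB 1≤dxv ⟩
      charge t + b  ∎

  -- Dequeuing releases one unit of the unit potential, so `slots` drops by one, and the released
  -- charge covers the clock, so the budget `b` stays the same.
  ⟶-within : ∀ {s′} → Within slots b s → s ⟶ s′ → ∃[ slots′ ] (slots ≡ suc slots′ × Within slots′ b s′)
  ⟶-within {slots} {b} {s} w (iterate i) = decrease slots 1+rest≤slots (w .slots≤)
    where
    t = lookup (Q s) i
    q = removeAt (Q s) i
    rest = clock s + potential charge (M s) q
    1+rest≤slots : suc (potential (λ _ → 1) (M s) q) ≤ slots
    1+rest≤slots = subst (_≤ slots) (potential-dequeue (λ _ → 1) (M s) (Q s) i) (w .potential≤)
    swap : ∀ c g p → c + (g + p) ≡ g + (c + p)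
    swap = solve-∀
    charge+rest≤b : charge t + rest ≤ b
    charge+rest≤b = begin
      charge t + rest                                    ≡⟨ swap (clock s) (charge t) _ ⟨
      clock s + (charge t + potential charge (M s) q)    ≡⟨ cong (clock s +_) (potential-dequeue charge (M s) (Q s) i) ⟨
      clock s + potential charge (M s) (Q s)             ≤⟨ w .clock≤ ⟩
      b                                                  ∎
      where open ≤-Reasoning
    q≤ : length q ≤ volume
    q≤ = ≤-trans (length≤potential (M s) q) (≤-trans (<⇒≤ 1+rest≤slots) (w .slots≤))
    -- With `slots` generalised, matching on the inequality exposes its predecessor.
    decrease : ∀ slots → suc (potential (λ _ → 1) (M s) q) ≤ slots → slots ≤ volume →
      ∃[ slots′ ] (slots ≡ suc slots′ × Within slots′ b (tick (process t (dequeue s i))))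
    decrease (suc slots′) (s≤s rest≤slots′) 1+slots′≤ = slots′ , refl ,
      weaken charge+rest≤b (process-within t (All.lookup (w .allowed) (∈-lookup i)) record
        { allowed    = All-removeAt i (w .allowed)
        ; slots≤     = <⇒≤ 1+slots′≤
        ; potential≤ = rest≤slots′
        -- The tick of `dequeue` makes the intermediate budget exactly `1 + rest`.
        ; clock≤     = ≤-refl
        ; peak≤      = tick-peak≤ (record s { Q = q }) q≤ (w .peak≤)
        })

  -- Structural recursion on `slots`, which strictly decreases with each iteration.
  within⇒terminates : ∀ slots → Within slots b s → Acc (flip _⟶_) s
  within⇒terminates slots w = acc λ step → next slots (⟶-within w step)
    where
    next : ∀ slots {s′} → ∃[ slots′ ] (slots ≡ suc slots′ × Within slots′ _ s′) → Acc (flip _⟶_) s′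
    next (suc slots) (_ , refl , w′) = within⇒terminates slots w′

  ⟶*-within : ∀ {s′} → Within slots b s → s ⟶* s′ → ∃[ slots′ ] Within slots′ b s′
  ⟶*-within w ε              = _ , w
  ⟶*-within w (step ◅ steps) = let _ , _ , w′ = ⟶-within w step in ⟶*-within w′ steps

  runsInTime : initialBudget ≤ b → RunsInTime G 𝒢 b
  runsInTime ≤b = within⇒terminates volume initial-within ,
    -- The charge not yet spent is dropped from the bound.
    λ steps → ≤-trans (m+n≤o⇒m≤o _ (⟶*-within initial-within steps .proj₂ .clock≤)) ≤b

  usesSpace : UsesSpace G 𝒢 (9 * volume)
  usesSpace steps = ⟶*-within initial-within steps .proj₂ .peak≤

  -- The total charge and the budget

  length-edgeEnds≤ : length edgeEnds ≤ ∣E∣ G * 2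
  length-edgeEnds≤ = subst (λ l → length edgeEnds ≤ l * 2) (length-tabulate {n = ∣E∣ G} _)
    (length-concatMap≤ _ 2 (All.universal (λ _ → ≤-refl) (allFin (∣E∣ G))))

  -- Handshake count: each degree term sums to at most 2∣E∣ over its own vertex and is repeated ∣V∣
  -- times for the other; the diagonal adds ∣V∣.
  ∑∑d≤ : ∑[ x < ∣V∣ G ] ∑[ v < ∣V∣ G ] d x v ≤ ∣V∣ G * (1 + 4 * ∣E∣ G)
  ∑∑d≤ = begin
    ∑[ x < ∣V∣ G ] ∑[ v < ∣V∣ G ] d x v
      ≡⟨ sum-cong-≗ ∑d ⟩
    ∑[ x < ∣V∣ G ] (∣V∣ G * occurrences x edgeEnds + suc l)
      ≡⟨ ∑-distrib-+ (λ x → ∣V∣ G * occurrences x edgeEnds) (λ _ → suc l) ⟩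
    ∑[ x < ∣V∣ G ] (∣V∣ G * occurrences x edgeEnds) + ∑[ x < ∣V∣ G ] suc l
      ≡⟨ cong₂ _+_ (sym (*-distribˡ-sum (∣V∣ G) (λ x → occurrences x edgeEnds))) (∑-const (∣V∣ G) (suc l)) ⟩
    ∣V∣ G * ∑[ x < ∣V∣ G ] occurrences x edgeEnds + ∣V∣ G * suc l
      ≡⟨ cong (λ k → ∣V∣ G * k + ∣V∣ G * suc l) (∑-occurrences edgeEnds) ⟩
    ∣V∣ G * l + ∣V∣ G * suc l
      ≤⟨ +-mono-≤ (*-monoʳ-≤ (∣V∣ G) length-edgeEnds≤) (*-monoʳ-≤ (∣V∣ G) (s≤s length-edgeEnds≤)) ⟩
    ∣V∣ G * (∣E∣ G * 2) + ∣V∣ G * (1 + ∣E∣ G * 2)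
      ≡⟨ collect (∣V∣ G) (∣E∣ G) ⟩
    ∣V∣ G * (1 + 4 * ∣E∣ G)  ∎
    where
    open ≤-Reasoning
    l = length edgeEnds
    ∑d : ∀ x → ∑[ v < ∣V∣ G ] d x v ≡ ∣V∣ G * occurrences x edgeEnds + suc l
    ∑d x = trans (∑-distrib-+ (λ _ → occurrences x edgeEnds) (λ v → occurrences v (x ∷ edgeEnds)))
      (cong₂ _+_ (∑-const (∣V∣ G) _) (∑-occurrences (x ∷ edgeEnds)))
    collect : ∀ n m → n * (m * 2) + n * (1 + m * 2) ≡ n * (1 + 4 * m)
    collect = solve-∀

  -- The charge is a product of a factor in `B` and a factor in `(x , v)`, so the triple sum
  -- factors. By TALNF a production mentions at most two nonterminals.
  totalCharge≤ : TALNF 𝒢 → totalCharge ≤ 18 * (∣P∣ 𝒢 * 2) * (∣V∣ G * (1 + 4 * ∣E∣ G))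
  totalCharge≤ talnf = begin
    totalCharge
      ≡⟨ unset-constant charge ⟩
    ∑[ B < ∣N∣ 𝒢 ] ∑[ x < ∣V∣ G ] ∑[ v < ∣V∣ G ] (18 * r B * d x v)
      ≡⟨ sum-cong-≗ (λ B → trans
           (sum-cong-≗ (λ x → sym (*-distribˡ-sum (18 * r B) (d x))))
           (sym (*-distribˡ-sum (18 * r B) (λ x → ∑ (d x))))) ⟩
    ∑[ B < ∣N∣ 𝒢 ] (18 * r B * D)
      ≡⟨ *-distribʳ-sum D (λ B → 18 * r B) ⟨
    ∑[ B < ∣N∣ 𝒢 ] (18 * r B) * D
      ≡⟨ cong (_* D) (sym (*-distribˡ-sum 18 r)) ⟩
    18 * ∑[ B < ∣N∣ 𝒢 ] r B * D
      ≡⟨ cong (λ k → 18 * k * D) (∑-occurrences nonterminalOccurrences) ⟩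
    18 * length nonterminalOccurrences * D
      ≤⟨ *-mono-≤ (*-monoʳ-≤ 18 (length-concatMap≤ nonterminals 2 (All.map length-nonterminals≤2 talnf))) ∑∑d≤ ⟩
    18 * (∣P∣ 𝒢 * 2) * (∣V∣ G * (1 + 4 * ∣E∣ G))  ∎
    where
    open ≤-Reasoning
    D = ∑[ x < ∣V∣ G ] ∑[ v < ∣V∣ G ] d x v

  -- The leading coefficient is 144 = 18 · 2 · 4; the added ones in the three factors absorb all
  -- lower-order terms.
  initialBudget≤ : TALNF 𝒢 → initialBudget ≤ 144 * ((1 + ∣P∣ 𝒢) * (1 + ∣E∣ G) * (1 + ∣V∣ G))
  initialBudget≤ talnf = begin
    initialBudget
      ≤⟨ s≤s (+-monoʳ-≤ (1 + v * 5) (+-monoʳ-≤ p (+-monoʳ-≤ (1 + p * (1 + (1 + m * 6))) (totalCharge≤ talnf)))) ⟩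
    1 + (1 + v * 5 + (p + (1 + p * (1 + (1 + m * 6)) + 18 * (p * 2) * (v * (1 + 4 * m)))))
      -- The added polynomial is the exact difference of the two sides.
      ≤⟨ m≤m+n _ (141 + 141 * p + 144 * m + 139 * v + 138 * (p * m) + 108 * (p * v) + 144 * (m * v)) ⟩
    1 + (1 + v * 5 + (p + (1 + p * (1 + (1 + m * 6)) + 18 * (p * 2) * (v * (1 + 4 * m)))))
      + (141 + 141 * p + 144 * m + 139 * v + 138 * (p * m) + 108 * (p * v) + 144 * (m * v))
      ≡⟨ expand p m v ⟩
    144 * ((1 + p) * (1 + m) * (1 + v))  ∎
    where
    open ≤-Reasoning
    p = ∣P∣ 𝒢
    m = ∣E∣ G
    v = ∣V∣ G
    expand : ∀ p m n →
      1 + (1 + n * 5 + (p + (1 + p * (1 + (1 + m * 6)) + 18 * (p * 2) * (n * (1 + 4 * m)))))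
        + (141 + 141 * p + 144 * m + 139 * n + 138 * (p * m) + 108 * (p * n) + 144 * (m * n))
      ≡ 144 * ((1 + p) * (1 + m) * (1 + n))
    expand = solve-∀

  runsInTime-master : TALNF 𝒢 → 144 * ((1 + ∣P∣ 𝒢) * (1 + ∣E∣ G) * (1 + ∣V∣ G)) ≤ b → RunsInTime G 𝒢 b
  runsInTime-master talnf ≤b = runsInTime (≤-trans (initialBudget≤ talnf) ≤b)

-- From the common bound to the asymptotic forms

1+n≤2*n : ∀ {n} → 1 ≤ n → 1 + n ≤ 2 * n
1+n≤2*n {n} 1≤n = +-mono-≤ 1≤n (m≤m+n n 0)

1≤∣E∣⇒1≤∣V∣ : ∀ {σ} (G : LabeledDigraph σ) → 1 ≤ ∣E∣ G → 1 ≤ ∣V∣ G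
1≤∣E∣⇒1≤∣V∣ G 1≤m with ∣E∣ G | LabeledDigraph.source G
-- The source of the first edge is an element of `Fin (∣V∣ G)`, which excludes the case 0.
1≤∣E∣⇒1≤∣V∣ G (s≤s _) | suc _ | src with ∣V∣ G | src zero
... | suc _ | _ = s≤s z≤n

1+m≤[1+c]*n : ∀ c {m n} → 1 ≤ n → m ≤ c * n → 1 + m ≤ (1 + c) * n
1+m≤[1+c]*n c 1≤n m≤cn = +-mono-≤ 1≤n m≤cn

theorem3p6 : (∃[ C ] (∀ {σ} (G : LabeledDigraph σ) (𝒢 : CFG σ) → TALNF 𝒢 →
    1 ≤ ∣P∣ 𝒢 → 1 ≤ ∣E∣ G →
    RunsInTime G 𝒢 (C * (∣P∣ 𝒢 * ∣E∣ G * ∣V∣ G))))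
    ×
    (∃[ C ] (∀ {σ} (G : LabeledDigraph σ) (𝒢 : CFG σ) → TALNF 𝒢 →
    UsesSpace G 𝒢 (C * (∣N∣ 𝒢 * ∣V∣ G ^ 2))))
    ×
    (∀ (c : ℕ) → ∃[ C ] (∀ {σ} (G : LabeledDigraph σ) (𝒢 : CFG σ) → TALNF 𝒢 →
    1 ≤ ∣P∣ 𝒢 → 1 ≤ ∣V∣ G → ∣E∣ G ≤ c * ∣V∣ G →
    RunsInTime G 𝒢 (C * (∣P∣ 𝒢 * ∣V∣ G ^ 2))))
    ×
    (∀ (c : ℕ) {σ} (𝒢 : CFG σ) → TALNF 𝒢 → ∀ (k : ℕ) → .{{_ : NonZero k}} →
    ∃[ n₀ ] (∀ (G : LabeledDigraph σ) → n₀ ≤ ∣V∣ G → ∣E∣ G ≤ c * ∣V∣ G →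
    RunsInTime G 𝒢 (∣V∣ G ^ 3 / k)))
-- Replacing 1 + n by 2n three times gives 1152 = 144 · 8. In the sparse case this is done twice,
-- and 1 + ∣E∣ is replaced by (1 + c)∣V∣, giving 576(1 + c).
theorem3p6 = (1152 , dense) , (9 , compact) , (λ c → 576 * (1 + c) , sparse c) , subcubic
  where
  dense : ∀ {σ} (G : LabeledDigraph σ) (𝒢 : CFG σ) → TALNF 𝒢 → 1 ≤ ∣P∣ 𝒢 → 1 ≤ ∣E∣ G →
    RunsInTime G 𝒢 (1152 * (∣P∣ 𝒢 * ∣E∣ G * ∣V∣ G))
  dense G 𝒢 talnf 1≤p 1≤m = runsInTime-master G 𝒢 talnf (begin
    144 * ((1 + ∣P∣ 𝒢) * (1 + ∣E∣ G) * (1 + ∣V∣ G))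
      ≤⟨ *-monoʳ-≤ 144 (*-mono-≤ (*-mono-≤ (1+n≤2*n 1≤p) (1+n≤2*n 1≤m)) (1+n≤2*n (1≤∣E∣⇒1≤∣V∣ G 1≤m))) ⟩
    144 * (2 * ∣P∣ 𝒢 * (2 * ∣E∣ G) * (2 * ∣V∣ G))
      ≡⟨ collect (∣P∣ 𝒢) (∣E∣ G) (∣V∣ G) ⟩
    1152 * (∣P∣ 𝒢 * ∣E∣ G * ∣V∣ G)  ∎)
    where
    open ≤-Reasoning
    collect : ∀ p m n → 144 * (2 * p * (2 * m) * (2 * n)) ≡ 1152 * (p * m * n)
    collect = solve-∀

  compact : ∀ {σ} (G : LabeledDigraph σ) (𝒢 : CFG σ) → TALNF 𝒢 → UsesSpace G 𝒢 (9 * (∣N∣ 𝒢 * ∣V∣ G ^ 2))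
  -- `∣V∣ G ^ 2` unfolds to `∣V∣ G * (∣V∣ G * 1)`.
  compact G 𝒢 _ {s} = subst (λ k → UsesSpace G 𝒢 (9 * (∣N∣ 𝒢 * (∣V∣ G * k)))) (sym (*-identityʳ (∣V∣ G)))
    (usesSpace G 𝒢) {s}

  sparse : ∀ c {σ} (G : LabeledDigraph σ) (𝒢 : CFG σ) → TALNF 𝒢 → 1 ≤ ∣P∣ 𝒢 → 1 ≤ ∣V∣ G → ∣E∣ G ≤ c * ∣V∣ G →
    RunsInTime G 𝒢 (576 * (1 + c) * (∣P∣ 𝒢 * ∣V∣ G ^ 2))
  sparse c G 𝒢 talnf 1≤p 1≤n m≤cn = runsInTime-master G 𝒢 talnf (begin
    144 * ((1 + ∣P∣ 𝒢) * (1 + ∣E∣ G) * (1 + ∣V∣ G))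
      ≤⟨ *-monoʳ-≤ 144 (*-mono-≤ (*-mono-≤ (1+n≤2*n 1≤p) (1+m≤[1+c]*n c 1≤n m≤cn)) (1+n≤2*n 1≤n)) ⟩
    144 * (2 * ∣P∣ 𝒢 * ((1 + c) * ∣V∣ G) * (2 * ∣V∣ G))
      ≡⟨ collect c (∣P∣ 𝒢) (∣V∣ G) ⟩
    576 * (1 + c) * (∣P∣ 𝒢 * ∣V∣ G ^ 2)  ∎)
    where
    open ≤-Reasoning
    collect : ∀ c p n → 144 * (2 * p * ((1 + c) * n) * (2 * n)) ≡ 576 * (1 + c) * (p * (n * (n * 1)))
    collect = solve-∀

  -- Running time o(n³) for a fixed grammar: the bound is a constant times n², which n³ / k
  -- eventually exceeds for every k.
  subcubic : ∀ c {σ} (𝒢 : CFG σ) → TALNF 𝒢 → ∀ k → .{{_ : NonZero k}} →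
    ∃[ n₀ ] (∀ (G : LabeledDigraph σ) → n₀ ≤ ∣V∣ G → ∣E∣ G ≤ c * ∣V∣ G → RunsInTime G 𝒢 (∣V∣ G ^ 3 / k))
  -- The threshold K + 1 gives both 1 ≤ n and K ≤ n, so K n² ≤ n³; the factor k inside `K`
  -- compensates for the division.
  subcubic c 𝒢 talnf k = suc K , λ G n₀≤n m≤cn →
    let n = ∣V∣ G; 1≤n = ≤-trans (s≤s z≤n) n₀≤n in
    runsInTime-master G 𝒢 talnf (begin
      T G                  ≡⟨ m*n/n≡m (T G) k ⟨
      T G * k / k          ≤⟨ /-monoˡ-≤ k (*-monoˡ-≤ k (*-monoʳ-≤ 144
                                (*-mono-≤ (*-monoʳ-≤ (1 + ∣P∣ 𝒢) (1+m≤[1+c]*n c 1≤n m≤cn)) (1+n≤2*n 1≤n)))) ⟩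
      144 * ((1 + ∣P∣ 𝒢) * ((1 + c) * n) * (2 * n)) * k / k
                           ≡⟨ cong (_/ k) (collect c (∣P∣ 𝒢) n k) ⟩
      K * n ^ 2 / k        ≤⟨ /-monoˡ-≤ k (*-monoˡ-≤ (n ^ 2) (<⇒≤ n₀≤n)) ⟩
      n ^ 3 / k            ∎)
    where
    open ≤-Reasoning
    K = 288 * (1 + ∣P∣ 𝒢) * (1 + c) * k
    T : LabeledDigraph _ → ℕ
    T G = 144 * ((1 + ∣P∣ 𝒢) * (1 + ∣E∣ G) * (1 + ∣V∣ G))
    collect : ∀ c p n k → 144 * ((1 + p) * ((1 + c) * n) * (2 * n)) * k ≡ 288 * (1 + p) * (1 + c) * k * (n * (n * 1))
    collect = solve-∀
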